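{- For all real numbers $x > 0$ and $c > 0$, $$\lim_{m \to \infty} \beta^2_m(x, c) = \sqrt{x},$$ where $m$ ranges over the positive integers.
   Context: For a positive integer $m$ and real numbers $x>0$, $c>0$, the square-root (binomial) biroot approximant of order $m$ is $$\beta^2_m(x,c) = \frac{\displaystyle\sum_{k=0}^{\lceil m/2 \rceil} x^k\, c^{m-2k} \binom{m}{2k}}{\displaystyle\sum_{k=0}^{\lceil m/2 \rceil - 1} x^k\, c^{m-2k-1} \binom{m}{2k+1}}.$$ Binomial coefficients $\binom{a}{b}$ with $b>a\ge 0$ are equal to $0$. Exponents of $c$ are integers and may be negative (in which case the binomial coefficient vanishes). -}

module Defs where

open import Data.Integer as ℤ using (ℤ; +_; -[1+_])
open import Data.Nat as ℕ using (ℕ; zero; suc; ⌈_/2⌉)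
open import Data.Nat.Combinatorics using (_C_; nC1≡n)
import Data.Nat.Properties as ℕP
import Data.Integer.Properties as ℤP
open import Data.Product using (∃; _×_; _,_; proj₁; proj₂)
open import Data.Rational
open import Data.Rational.Properties
open import Data.Rational.Solver using (module +-*-Solver)
import Data.Rational.Unnormalised as ℚᵘ
open import Data.Sum using (inj₁; inj₂)
open import Relation.Binary.PropositionalEquality
  using (_≡_; refl; sym; trans; cong; cong₂; subst; subst₂)
open import Relation.Nullary using (¬_; Dec; yes; no; contradiction)

module ℚLemmas where

  open +-*-Solver

  0<1 : 0ℚ < 1ℚ
  0<1 = positive⁻¹ 1ℚ

  0<½ : 0ℚ < ½
  0<½ = positive⁻¹ ½

  ≤-from : ∀ {p q e} → 0ℚ ≤ e → p + e ≡ q → p ≤ q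
  ≤-from {p} 0≤e eq = subst₂ _≤_ (+-identityʳ p) eq (+-monoʳ-≤ p 0≤e)

  <-from : ∀ {p q e} → 0ℚ < e → p + e ≡ q → p < q
  <-from {p} 0<e eq = subst₂ _<_ (+-identityʳ p) eq (+-monoʳ-< p 0<e)

  ≤-diff : ∀ {p q} → p ≤ q → 0ℚ ≤ q - p
  ≤-diff {p} {q} p≤q = subst (_≤ q - p) (+-inverseʳ p) (+-monoˡ-≤ (- p) p≤q)

  <-diff : ∀ {p q} → p < q → 0ℚ < q - p
  <-diff {p} {q} p<q = subst (_< q - p) (+-inverseʳ p) (+-monoˡ-< (- p) p<q)

  +-nn : ∀ {p q} → 0ℚ ≤ p → 0ℚ ≤ q → 0ℚ ≤ p + q
  +-nn = +-mono-≤

  +-pos : ∀ {p q} → 0ℚ < p → 0ℚ < q → 0ℚ < p + q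
  +-pos = +-mono-<

  *-monoˡ : ∀ {r p q} → 0ℚ ≤ r → p ≤ q → r * p ≤ r * q
  *-monoˡ {r} 0≤r = *-monoˡ-≤-nonNeg r {{nonNegative 0≤r}}

  *-monoʳ : ∀ {r p q} → 0ℚ ≤ r → p ≤ q → p * r ≤ q * r
  *-monoʳ {r} 0≤r = *-monoʳ-≤-nonNeg r {{nonNegative 0≤r}}

  *-mono< : ∀ {r p q} → 0ℚ < r → p < q → r * p < r * q
  *-mono< {r} 0<r = *-monoʳ-<-pos r {{positive 0<r}}

  *-nn : ∀ {p q} → 0ℚ ≤ p → 0ℚ ≤ q → 0ℚ ≤ p * q
  *-nn {p} {q} 0≤p 0≤q = subst (_≤ p * q) (*-zeroʳ p) (*-monoˡ 0≤p 0≤q)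

  *-pos : ∀ {p q} → 0ℚ < p → 0ℚ < q → 0ℚ < p * q
  *-pos {p} {q} 0<p 0<q = subst (_< p * q) (*-zeroʳ p) (*-mono< 0<p 0<q)

  *-mono : ∀ {p q r s} → 0ℚ ≤ p → 0ℚ ≤ s → p ≤ q → r ≤ s → p * r ≤ q * s
  *-mono 0≤p 0≤s p≤q r≤s = ≤-trans (*-monoˡ 0≤p r≤s) (*-monoʳ 0≤s p≤q)

  half : ∀ {ε} → 0ℚ < ε → 0ℚ < ½ * ε
  half = *-pos 0<½

  half+half : ∀ ε → ½ * ε + ½ * ε ≡ ε
  half+half = solve 1 (λ e → con ½ :* e :+ con ½ :* e := e) refl

  p≤∣p∣ : ∀ p → p ≤ ∣ p ∣
  p≤∣p∣ p with ≤-total 0ℚ p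
  ... | inj₁ 0≤p = ≤-reflexive (sym (0≤p⇒∣p∣≡p 0≤p))
  ... | inj₂ p≤0 = ≤-trans p≤0 (0≤∣p∣ p)

  -p≤∣p∣ : ∀ p → - p ≤ ∣ p ∣
  -p≤∣p∣ p = subst (- p ≤_) (∣-p∣≡∣p∣ p) (p≤∣p∣ (- p))

  ∣∣-< : ∀ {p ε} → p < ε → - p < ε → ∣ p ∣ < ε
  ∣∣-< {p} {ε} p<ε -p<ε with ∣p∣≡p∨∣p∣≡-p p
  ... | inj₁ eq = subst (_< ε) (sym eq) p<ε
  ... | inj₂ eq = subst (_< ε) (sym eq) -p<ε

  swap-∣-∣ : ∀ p q → ∣ p - q ∣ ≡ ∣ q - p ∣
  swap-∣-∣ p q = trans (sym (∣-p∣≡∣p∣ (p - q))) (cong ∣_∣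
    (solve 2 (λ p q → :- (p :- q) := q :- p) refl p q))

  ∣∣-lipschitz : ∀ p q → ∣ p ∣ - ∣ q ∣ ≤ ∣ p - q ∣
  ∣∣-lipschitz p q = ≤-from
    (≤-diff (subst (λ t → ∣ t ∣ ≤ ∣ p - q ∣ + ∣ q ∣)
      (solve 2 (λ p q → (p :- q) :+ q := p) refl p q)
      (∣p+q∣≤∣p∣+∣q∣ (p - q) q)))
    (solve 3 (λ a b c → (a :- b) :+ ((c :+ b) :- a) := c) refl
      (∣ p ∣) (∣ q ∣) (∣ p - q ∣))

  -- Totalised by 0 ↦ 0, so that a real can be inverted entrywise although finitely
  -- many entries of its sequence may vanish.
  inv : ℚ → ℚ
  inv p with p ≟ 0ℚ
  ... | yes _   = 0ℚ
  ... | no  p≢0 = (1/ p) {{≢-nonZero p≢0}}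

  inv-pos : ∀ {p} → 0ℚ < p → 0ℚ < inv p
  inv-pos {p} 0<p with p ≟ 0ℚ
  ... | yes p≡0 = contradiction (sym p≡0) (<⇒≢ 0<p)
  ... | no  p≢0 = positive⁻¹ _ {{1/pos⇒pos p {{positive 0<p}}}}

  inv-inverse : ∀ {p} → 0ℚ < p → p * inv p ≡ 1ℚ
  inv-inverse {p} 0<p with p ≟ 0ℚ
  ... | yes p≡0 = contradiction (sym p≡0) (<⇒≢ 0<p)
  ... | no  p≢0 = *-inverseʳ p {{≢-nonZero p≢0}}

  inv-anti : ∀ {p q} → 0ℚ < p → p ≤ q → inv q ≤ inv p
  inv-anti {p} {q} 0<p p≤q = subst₂ _≤_ lhs rhs
    (*-monoˡ (<⇒≤ (*-pos (inv-pos 0<p) (inv-pos 0<q))) p≤q)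
    where
    0<q = <-≤-trans 0<p p≤q
    lhs : inv p * inv q * p ≡ inv q
    lhs = trans (solve 3 (λ p a b → a :* b :* p := p :* a :* b) refl p (inv p) (inv q))
      (trans (cong (_* inv q) (inv-inverse 0<p)) (*-identityˡ (inv q)))
    rhs : inv p * inv q * q ≡ inv p
    rhs = trans (solve 3 (λ q a b → a :* b :* q := q :* b :* a) refl q (inv p) (inv q))
      (trans (cong (_* inv p) (inv-inverse 0<q)) (*-identityˡ (inv p)))

  inv-diff : ∀ {p q} → 0ℚ < p → 0ℚ < q → inv p - inv q ≡ inv p * inv q * (q - p)
  inv-diff {p} {q} 0<p 0<q = sym (trans
    (solve 4 (λ p q a b → a :* b :* (q :- p) := q :* b :* a :- p :* a :* b) refl
      p q (inv p) (inv q))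
    (cong₂ _-_
      (trans (cong (_* inv p) (inv-inverse 0<q)) (*-identityˡ (inv p)))
      (trans (cong (_* inv q) (inv-inverse 0<p)) (*-identityˡ (inv q)))))

  shrink : ∀ {B ε} → 0ℚ < B → 0ℚ < ε → ∃ λ δ → 0ℚ < δ × B * δ ≡ ε
  shrink {B} {ε} 0<B 0<ε = inv B * ε , *-pos (inv-pos 0<B) 0<ε ,
    trans (sym (*-assoc B (inv B) ε))
      (trans (cong (_* ε) (inv-inverse 0<B)) (*-identityˡ ε))

  ℕ→ℚ : ℕ → ℚ
  ℕ→ℚ n = + n / 1

  ℕ→ℚ-suc : ∀ n → ℕ→ℚ (suc n) ≡ 1ℚ + ℕ→ℚ n
  ℕ→ℚ-suc n = toℚᵘ-injective (ℚᵘ-trans (toℚᵘ-fromℚᵘ (+ suc n ℚᵘ./ 1))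
    (ℚᵘ-trans (ℚᵘ.*≡* (cong (ℤ._* + 1) (cong₂ ℤ._+_ {+ 1} {+ 1} refl (sym (ℤP.*-identityʳ (+ n))))))
      (ℚᵘ-sym (ℚᵘ-trans (toℚᵘ-homo-+ 1ℚ (ℕ→ℚ n))
        (ℚᵘP.+-cong (ℚᵘP.≃-refl {toℚᵘ 1ℚ}) (toℚᵘ-fromℚᵘ (+ n ℚᵘ./ 1)))))))
    where
    import Data.Rational.Unnormalised.Properties as ℚᵘP
    ℚᵘ-trans = λ {p q r} → ℚᵘP.≃-trans {p} {q} {r}
    ℚᵘ-sym = λ {p q} → ℚᵘP.≃-sym {p} {q}

  ℕ→ℚ-nn : ∀ n → 0ℚ ≤ ℕ→ℚ n
  ℕ→ℚ-nn n = nonNegative⁻¹ _ {{normalize-nonNeg n 1}}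

  ℕ→ℚ-pos : ∀ n .{{_ : ℕ.NonZero n}} → 0ℚ < ℕ→ℚ n
  ℕ→ℚ-pos n = positive⁻¹ _ {{normalize-pos n 1}}

  ℕ→ℚ-mono : ∀ {m n} → m ℕ.≤ n → ℕ→ℚ m ≤ ℕ→ℚ n
  ℕ→ℚ-mono {n = n} ℕ.z≤n = ℕ→ℚ-nn n
  ℕ→ℚ-mono (ℕ.s≤s {m} {n} m≤n) = subst₂ _≤_ (sym (ℕ→ℚ-suc m)) (sym (ℕ→ℚ-suc n))
    (+-monoʳ-≤ 1ℚ (ℕ→ℚ-mono m≤n))

  archimedean : ∀ q → ∃ λ n → q ≤ ℕ→ℚ n
  archimedean q@(mkℚ p d _) = ℤ.∣ p ∣ , toℚᵘ-cancel-≤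
    (ℚᵘP.≤-trans (ℚᵘ.*≤* bound)
      (ℚᵘP.≤-reflexive (ℚᵘP.≃-sym (toℚᵘ-fromℚᵘ (+ ℤ.∣ p ∣ ℚᵘ./ 1)))))
    where
    import Data.Rational.Unnormalised.Properties as ℚᵘP
    i≤∣i∣ : ∀ i → i ℤ.≤ + ℤ.∣ i ∣
    i≤∣i∣ (+ n)    = ℤP.≤-refl
    i≤∣i∣ -[1+ n ] = ℤ.-≤+
    bound : p ℤ.* + 1 ℤ.≤ + ℤ.∣ p ∣ ℤ.* + suc d
    bound = ℤP.≤-trans (ℤP.≤-reflexive (ℤP.*-identityʳ p)) (ℤP.≤-trans (i≤∣i∣ p)
      (subst (+ ℤ.∣ p ∣ ℤ.≤_) (ℤP.pos-* ℤ.∣ p ∣ (suc d))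
        (ℤ.+≤+ (ℕP.m≤m*n ℤ.∣ p ∣ (suc d)))))

  ½^ : ℕ → ℚ
  ½^ zero    = 1ℚ
  ½^ (suc n) = ½ * ½^ n

  ½^-pos : ∀ n → 0ℚ < ½^ n
  ½^-pos zero    = 0<1
  ½^-pos (suc n) = half (½^-pos n)

  ½^-bound : ∀ n → ½^ n * (1ℚ + ℕ→ℚ n) ≤ 1ℚ
  ½^-bound zero    = ≤-refl
  ½^-bound (suc n) = ≤-trans (≤-from
    (*-nn (<⇒≤ 0<½) (*-nn (<⇒≤ (½^-pos n)) (ℕ→ℚ-nn n)))
    (trans (cong (λ t → ½ * ½^ n * (1ℚ + t) + ½ * (½^ n * ℕ→ℚ n)) (ℕ→ℚ-suc n))
      (solve 2 (λ h t → con ½ :* h :* (con 1ℚ :+ (con 1ℚ :+ t)) :+ con ½ :* (h :* t)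
                     := h :* (con 1ℚ :+ t)) refl (½^ n) (ℕ→ℚ n))))
    (½^-bound n)

open ℚLemmas

Eventually : (ℕ → Set) → Set
Eventually P = ∃ λ N → ∀ n → N ℕ.≤ n → P n

module _ {P Q : ℕ → Set} where

  ev-map : (∀ n → P n → Q n) → Eventually P → Eventually Q
  ev-map f (N , p) = N , λ n N≤n → f n (p n N≤n)

  ev-× : Eventually P → Eventually Q → Eventually (λ n → P n × Q n)
  ev-× (M , p) (N , q) = M ℕ.⊔ N , λ n le →
    p n (ℕP.≤-trans (ℕP.m≤m⊔n M N) le) , q n (ℕP.≤-trans (ℕP.m≤n⊔m M N) le)

ev-contradiction : ∀ {P : ℕ → Set} → (∀ n → ¬ P n) → ¬ Eventually P
ev-contradiction f (N , p) = f N (p N ℕP.≤-refl)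

½^-small : ∀ {B ε} → 0ℚ < B → 0ℚ < ε → Eventually (λ n → ½^ n * B < ε)
½^-small {B} {ε} 0<B 0<ε with shrink 0<ε 0<B
... | K , 0<K , εK≡B with archimedean K
...   | N , K≤N = N , λ n N≤n →
  let h = ½^ n ; t = ℕ→ℚ n
      0≤t-K = ≤-diff (≤-trans K≤N (ℕ→ℚ-mono N≤n))
      step : h * B < h * (1ℚ + t) * ε
      step = <-from (*-pos (*-pos (½^-pos n) 0<ε) (+-mono-<-≤ 0<1 0≤t-K))
        (trans (cong (λ b → h * b + h * ε * (1ℚ + (t - K))) (sym εK≡B))
          (solve 4 (λ h e k t → h :* (e :* k) :+ h :* e :* (con 1ℚ :+ (t :- k))
                             := h :* (con 1ℚ :+ t) :* e) refl h ε K t))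
  in <-≤-trans step (subst (h * (1ℚ + t) * ε ≤_) (*-identityˡ ε)
       (*-monoʳ (<⇒≤ 0<ε) (½^-bound n)))
  where open +-*-Solver

Cauchy : (ℕ → ℚ) → Set
Cauchy s = ∀ ε → 0ℚ < ε →
  ∃ λ N → ∀ m n → N ℕ.≤ m → N ℕ.≤ n → ∣ s m - s n ∣ < ε

-- Constructive reals: no quotient is taken, equality is the relation _≃ᴿ_.
record ℝ : Set where
  constructor mkℝ
  field
    seq    : ℕ → ℚ
    cauchy : Cauchy seq

open ℝ public

infix 4 _≃ᴿ_ _<ᴿ_ _≤ᴿ_

_≃ᴿ_ : ℝ → ℝ → Set
x ≃ᴿ y = ∀ ε → 0ℚ < ε → Eventually (λ n → ∣ seq x n - seq y n ∣ < ε)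

_<ᴿ_ : ℝ → ℝ → Set
x <ᴿ y = ∃ λ ε → 0ℚ < ε × Eventually (λ n → seq x n + ε ≤ seq y n)

_≤ᴿ_ : ℝ → ℝ → Set
x ≤ᴿ y = ¬ (y <ᴿ x)

fromℚ : ℚ → ℝ
fromℚ q = mkℝ (λ _ → q) λ ε 0<ε → 0 , λ _ _ _ _ →
  subst (λ t → ∣ t ∣ < ε) (sym (+-inverseʳ q)) 0<ε

fromℕ : ℕ → ℝ
fromℕ n = fromℚ (+ n / 1)

0ᴿ 1ᴿ : ℝ
0ᴿ = fromℕ 0
1ᴿ = fromℕ 1

module CauchyLemmas where

  open +-*-Solver

  both : ∀ {s t} → Cauchy s → Cauchy t → ∀ ε → 0ℚ < ε →
    ∃ λ N → ∀ m n → N ℕ.≤ m → N ℕ.≤ n → ∣ s m - s n ∣ < ε × ∣ t m - t n ∣ < ε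
  both cs ct ε 0<ε with cs ε 0<ε | ct ε 0<ε
  ... | M , p | N , q = M ℕ.⊔ N , λ m n M⊔N≤m M⊔N≤n →
    p m n (ℕP.≤-trans (ℕP.m≤m⊔n M N) M⊔N≤m) (ℕP.≤-trans (ℕP.m≤m⊔n M N) M⊔N≤n) ,
    q m n (ℕP.≤-trans (ℕP.m≤n⊔m M N) M⊔N≤m) (ℕP.≤-trans (ℕP.m≤n⊔m M N) M⊔N≤n)

  bounded : ∀ {s} → Cauchy s →
    ∃ λ B → 0ℚ < B × Eventually (λ n → ∣ s n ∣ ≤ B)
  bounded {s} cs with cs 1ℚ 0<1
  ... | N , p = ∣ s N ∣ + 1ℚ , +-mono-≤-< (0≤∣p∣ (s N)) 0<1 , N , λ n N≤n →
    ≤-from (≤-diff (≤-trans (∣∣-lipschitz (s n) (s N)) (<⇒≤ (p n N N≤n ℕP.≤-refl))))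
      (solve 2 (λ a b → a :+ (con 1ℚ :- (a :- b)) := b :+ con 1ℚ) refl
        (∣ s n ∣) (∣ s N ∣))

  sum-close : ∀ a b c d {δ η} → ∣ a - b ∣ < δ → ∣ c - d ∣ < η →
    ∣ (a + c) - (b + d) ∣ < δ + η
  sum-close a b c d p q = ≤-<-trans
    (subst (λ z → ∣ z ∣ ≤ ∣ a - b ∣ + ∣ c - d ∣) (eq a b c d) (∣p+q∣≤∣p∣+∣q∣ (a - b) (c - d)))
    (+-mono-< p q)
    where
    eq : ∀ a b c d → (a - b) + (c - d) ≡ (a + c) - (b + d)
    eq = solve 4 (λ a b c d → (a :- b) :+ (c :- d) := (a :+ c) :- (b :+ d)) refl

  prod-close : ∀ a b c d {A B δ} → 0ℚ < A → 0ℚ < B → ∣ a ∣ ≤ A → ∣ d ∣ ≤ B →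
    ∣ a - b ∣ < δ → ∣ c - d ∣ < δ → ∣ a * c - b * d ∣ < (A + B) * δ
  prod-close a b c d {A} {B} {δ} 0<A 0<B bA bB p q = ≤-<-trans
    (subst (λ z → ∣ z ∣ ≤ ∣ u ∣ + ∣ v ∣) (eq a b c d) (∣p+q∣≤∣p∣+∣q∣ u v))
    (subst (∣ u ∣ + ∣ v ∣ <_) (sym (*-distribʳ-+ δ A B)) (+-mono-< hu hv))
    where
    u v : ℚ
    u = a * (c - d)
    v = d * (a - b)
    eq : ∀ a b c d → a * (c - d) + d * (a - b) ≡ a * c - b * d
    eq = solve 4 (λ a b c d → a :* (c :- d) :+ d :* (a :- b) := a :* c :- b :* d) refl
    hu : ∣ u ∣ < A * δ
    hu = subst (_< A * δ) (sym (∣p*q∣≡∣p∣*∣q∣ a (c - d)))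
      (≤-<-trans (*-monoʳ (0≤∣p∣ (c - d)) bA) (*-mono< 0<A q))
    hv : ∣ v ∣ < B * δ
    hv = subst (_< B * δ) (sym (∣p*q∣≡∣p∣*∣q∣ d (a - b)))
      (≤-<-trans (*-monoʳ (0≤∣p∣ (a - b)) bB) (*-mono< 0<B p))

  +-cauchy : ∀ {s t} → Cauchy s → Cauchy t → Cauchy (λ n → s n + t n)
  +-cauchy {s} {t} cs ct ε 0<ε =
    let (N , p) = both {s} {t} cs ct (½ * ε) (half 0<ε) in
    N , λ m n N≤m N≤n →
      subst (∣ (s m + t m) - (s n + t n) ∣ <_) (half+half ε)
        (sum-close (s m) (s n) (t m) (t n)
          (proj₁ (p m n N≤m N≤n)) (proj₂ (p m n N≤m N≤n)))

  neg-cauchy : ∀ {s} → Cauchy s → Cauchy (λ n → - s n)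
  neg-cauchy {s} cs ε 0<ε with cs ε 0<ε
  ... | N , p = N , λ m n N≤m N≤n → subst (λ t → ∣ t ∣ < ε)
    (solve 2 (λ a b → b :- a := (:- a) :- (:- b)) refl (s m) (s n)) (p n m N≤n N≤m)

  abs-cauchy : ∀ {s} → Cauchy s → Cauchy (λ n → ∣ s n ∣)
  abs-cauchy {s} cs ε 0<ε with cs ε 0<ε
  ... | N , p = N , λ m n N≤m N≤n → ∣∣-<
    (≤-<-trans (∣∣-lipschitz (s m) (s n)) (p m n N≤m N≤n))
    (≤-<-trans (subst (_≤ ∣ s n - s m ∣)
      (solve 2 (λ a b → b :- a := :- (a :- b)) refl (∣ s m ∣) (∣ s n ∣))
      (∣∣-lipschitz (s n) (s m))) (p n m N≤n N≤m))

  *-cauchy : ∀ {s t} → Cauchy s → Cauchy t → Cauchy (λ n → s n * t n)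
  *-cauchy {s} {t} cs ct ε 0<ε =
    let (A , 0<A , evA)  = bounded {s} cs
        (B , 0<B , evB)  = bounded {t} ct
        (δ , 0<δ , Kδ≡ε) = shrink (+-pos 0<A 0<B) 0<ε
        (M , p)          = both {s} {t} cs ct δ 0<δ
        (N , q)          = ev-× evA evB
    in M ℕ.⊔ N , λ m n le₁ le₂ →
      let M≤m = ℕP.≤-trans (ℕP.m≤m⊔n M N) le₁
          M≤n = ℕP.≤-trans (ℕP.m≤m⊔n M N) le₂
          N≤m = ℕP.≤-trans (ℕP.m≤n⊔m M N) le₁
          N≤n = ℕP.≤-trans (ℕP.m≤n⊔m M N) le₂
      in subst (∣ s m * t m - s n * t n ∣ <_) Kδ≡ε
        (prod-close (s m) (s n) (t m) (t n) 0<A 0<B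
          (proj₁ (q m N≤m)) (proj₂ (q n N≤n))
          (proj₁ (p m n M≤m M≤n)) (proj₂ (p m n M≤m M≤n)))

  inv-close : ∀ a b {δ η} → 0ℚ < δ → 0ℚ < η → δ ≤ a → δ ≤ b → ∣ b - a ∣ < η →
    ∣ inv a - inv b ∣ < inv δ * inv δ * η
  inv-close a b {δ} {η} 0<δ 0<η δ≤a δ≤b b-a<η =
    subst (_< inv δ * inv δ * η) (sym abs-eq)
      (<-≤-trans (*-mono< 0<k b-a<η) (*-monoʳ (<⇒≤ 0<η) k≤))
    where
    0<a : 0ℚ < a
    0<a = <-≤-trans 0<δ δ≤a
    0<b : 0ℚ < b
    0<b = <-≤-trans 0<δ δ≤b
    k : ℚ
    k = inv a * inv b
    0<k : 0ℚ < k
    0<k = *-pos (inv-pos 0<a) (inv-pos 0<b)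
    k≤ : k ≤ inv δ * inv δ
    k≤ = *-mono (<⇒≤ (inv-pos 0<a)) (<⇒≤ (inv-pos 0<δ)) (inv-anti 0<δ δ≤a) (inv-anti 0<δ δ≤b)
    abs-eq : ∣ inv a - inv b ∣ ≡ k * ∣ b - a ∣
    abs-eq = trans (cong ∣_∣ (inv-diff 0<a 0<b)) (trans (∣p*q∣≡∣p∣*∣q∣ k (b - a))
      (cong (_* ∣ b - a ∣) (0≤p⇒∣p∣≡p (<⇒≤ 0<k))))

  inv-cauchy : ∀ {s δ} → 0ℚ < δ → Eventually (λ n → δ ≤ s n) →
    Cauchy s → Cauchy (λ n → inv (s n))
  inv-cauchy {s} {δ} 0<δ (M , q) cs ε 0<ε =
    let (η , 0<η , Kη≡ε) = shrink (*-pos (inv-pos 0<δ) (inv-pos 0<δ)) 0<ε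
        (N , p)          = cs η 0<η
    in M ℕ.⊔ N , λ m n le₁ le₂ →
      subst (∣ inv (s m) - inv (s n) ∣ <_) Kη≡ε (inv-close (s m) (s n) 0<δ 0<η
        (q m (ℕP.≤-trans (ℕP.m≤m⊔n M N) le₁)) (q n (ℕP.≤-trans (ℕP.m≤m⊔n M N) le₂))
        (p n m (ℕP.≤-trans (ℕP.m≤n⊔m M N) le₂) (ℕP.≤-trans (ℕP.m≤n⊔m M N) le₁)))

open CauchyLemmas

infixl 6 _+ᴿ_ _-ᴿ_
infixl 7 _*ᴿ_
infix  8 -ᴿ_
infixr 9 _^ᴿ_

_+ᴿ_ : ℝ → ℝ → ℝ
x +ᴿ y = mkℝ (λ n → seq x n + seq y n) (+-cauchy {seq x} {seq y} (cauchy x) (cauchy y))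

_*ᴿ_ : ℝ → ℝ → ℝ
x *ᴿ y = mkℝ (λ n → seq x n * seq y n) (*-cauchy {seq x} {seq y} (cauchy x) (cauchy y))

-ᴿ_ : ℝ → ℝ
-ᴿ x = mkℝ (λ n → - seq x n) (neg-cauchy {seq x} (cauchy x))

_-ᴿ_ : ℝ → ℝ → ℝ
x -ᴿ y = x +ᴿ (-ᴿ y)

∣_∣ᴿ : ℝ → ℝ
∣ x ∣ᴿ = mkℝ (λ n → ∣ seq x n ∣) (abs-cauchy {seq x} (cauchy x))

_^ᴿ_ : ℝ → ℕ → ℝ
x ^ᴿ zero  = 1ᴿ
x ^ᴿ suc n = x *ᴿ x ^ᴿ n

pos-bound : ∀ x → 0ᴿ <ᴿ x → ∃ λ δ → 0ℚ < δ × Eventually (λ n → δ ≤ seq x n)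
pos-bound x (δ , 0<δ , ev) = δ , 0<δ , ev-map (λ n → subst (_≤ seq x n) (+-identityˡ δ)) ev

bound-pos : ∀ x {δ} → 0ℚ < δ → Eventually (λ n → δ ≤ seq x n) → 0ᴿ <ᴿ x
bound-pos x {δ} 0<δ ev = δ , 0<δ , ev-map (λ n → subst (_≤ seq x n) (sym (+-identityˡ δ))) ev

recip : (x : ℝ) → 0ᴿ <ᴿ x → ℝ
recip x 0<x = let (δ , 0<δ , ev) = pos-bound x 0<x in
  mkℝ (λ n → inv (seq x n)) (inv-cauchy {seq x} 0<δ ev (cauchy x))

zpow : (x : ℝ) → 0ᴿ <ᴿ x → ℤ → ℝ
zpow x 0<x (+ n)    = x ^ᴿ n
zpow x 0<x -[1+ n ] = recip x 0<x ^ᴿ suc n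

-- The upper limit is included.
Σ[0…_] : ℕ → (ℕ → ℝ) → ℝ
Σ[0… zero  ] f = f 0
Σ[0… suc n ] f = Σ[0… n ] f +ᴿ f (suc n)

module Sqrt where

  open +-*-Solver

  -- Bisection: after n steps, lo² ≤ a < hi² with hi - lo = (a + 1) / 2ⁿ.
  record Bracket (a : ℚ) (n : ℕ) : Set where
    field
      lo hi  : ℚ
      0≤lo   : 0ℚ ≤ lo
      lo≤hi  : lo ≤ hi
      hi≤    : hi ≤ a + 1ℚ
      lo²≤a  : lo * lo ≤ a
      a<hi²  : a < hi * hi
      width  : hi ≡ lo + ½^ n * (a + 1ℚ)

  refine : ∀ {a n} → 0ℚ ≤ a → Bracket a n → Bracket a (suc n)
  refine {a} {n} 0≤a b = go (mid * mid ≤? a)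
    where
    open Bracket b
    w mid : ℚ
    w = ½^ (suc n) * (a + 1ℚ)
    mid = lo + w
    0≤w : 0ℚ ≤ w
    0≤w = *-nn (<⇒≤ (½^-pos (suc n))) (+-nn 0≤a (<⇒≤ 0<1))
    split : ∀ l h a → l + h * a ≡ l + (½ * h) * a + (½ * h) * a
    split = solve 3 (λ l h a → l :+ h :* a := l :+ (con ½ :* h) :* a :+ (con ½ :* h) :* a) refl
    hi≡ : hi ≡ mid + w
    hi≡ = trans width (split lo (½^ n) (a + 1ℚ))
    lo≤mid : lo ≤ mid
    lo≤mid = ≤-from 0≤w refl
    mid≤hi : mid ≤ hi
    mid≤hi = ≤-from 0≤w (sym hi≡)
    go : Dec (mid * mid ≤ a) → Bracket a (suc n)
    go (yes mid²≤a) = record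
      { lo = mid ; hi = hi ; 0≤lo = ≤-trans 0≤lo lo≤mid ; lo≤hi = mid≤hi ; hi≤ = hi≤
      ; lo²≤a = mid²≤a ; a<hi² = a<hi² ; width = hi≡ }
    go (no mid²≰a) = record
      { lo = lo ; hi = mid ; 0≤lo = 0≤lo ; lo≤hi = lo≤mid ; hi≤ = ≤-trans mid≤hi hi≤
      ; lo²≤a = lo²≤a ; a<hi² = ≰⇒> mid²≰a ; width = refl }

  bisect : ∀ a → 0ℚ ≤ a → ∀ n → Bracket a n
  bisect a 0≤a zero = record
    { lo = 0ℚ ; hi = a + 1ℚ
    ; 0≤lo = ≤-refl ; lo≤hi = 0≤a+1 ; hi≤ = ≤-refl
    ; lo²≤a = 0≤a
    ; a<hi² = <-from (+-mono-≤-< (*-nn 0≤a 0≤a+1) 0<1)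
        (solve 1 (λ a → a :+ (a :* (a :+ con 1ℚ) :+ con 1ℚ)
                     := (a :+ con 1ℚ) :* (a :+ con 1ℚ)) refl a)
    ; width = solve 1 (λ a → a :+ con 1ℚ := con 0ℚ :+ con 1ℚ :* (a :+ con 1ℚ)) refl a
    }
    where 0≤a+1 = +-nn 0≤a (<⇒≤ 0<1)
  bisect a 0≤a (suc n) = refine 0≤a (bisect a 0≤a n)

  open Bracket

  close : ∀ {a b m n ε} (A : Bracket a m) (B : Bracket b n) → 0ℚ < ε →
    ½^ n * (b + 1ℚ) < ½ * ε → a - b < (½ * ε) * (½ * ε) → lo A - lo B < ε
  close {a} {b} {m} {n} {ε} A B 0<ε w<η a-b<η² =
    ≰⇒> λ ε≤ → <-irrefl refl (<-≤-trans (<-≤-trans a<hi²+η² (sq ε≤)) (lo²≤a A))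
    where
    η w : ℚ
    η = ½ * ε
    w = ½^ n * (b + 1ℚ)
    0≤hi : 0ℚ ≤ hi B
    0≤hi = ≤-trans (0≤lo B) (lo≤hi B)
    id₁ : ∀ lA lB e w → (lB + w) + ½ * e + ((lA - lB - e) + (½ * e - w)) ≡ lA
    id₁ = solve 4 (λ lA lB e w → (lB :+ w) :+ con ½ :* e :+ ((lA :- lB :- e) :+ (con ½ :* e :- w))
                              := lA) refl
    id₂ : ∀ h e → (h * h + e * e) + h * (e + e) ≡ (h + e) * (h + e)
    id₂ = solve 2 (λ h e → (h :* h :+ e :* e) :+ h :* (e :+ e) := (h :+ e) :* (h :+ e)) refl
    id₃ : ∀ a b e → a + (e - (a - b)) ≡ b + e
    id₃ = solve 3 (λ a b e → a :+ (e :- (a :- b)) := b :+ e) refl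
    hi+η≤lo : ε ≤ lo A - lo B → hi B + η ≤ lo A
    hi+η≤lo ε≤ = ≤-from (+-nn (≤-diff ε≤) (<⇒≤ (<-diff w<η)))
      (trans (cong (λ h → h + η + ((lo A - lo B - ε) + (η - w))) (width B))
        (id₁ (lo A) (lo B) ε w))
    0≤η : 0ℚ ≤ η
    0≤η = <⇒≤ (half 0<ε)
    sq : ε ≤ lo A - lo B → hi B * hi B + η * η ≤ lo A * lo A
    sq ε≤ = ≤-trans
      (≤-from (*-nn 0≤hi (+-nn 0≤η 0≤η)) (id₂ (hi B) η))
      (*-mono (+-nn 0≤hi 0≤η) (0≤lo A) (hi+η≤lo ε≤) (hi+η≤lo ε≤))
    a<hi²+η² : a < hi B * hi B + η * η
    a<hi²+η² = <-trans (<-from (<-diff a-b<η²) (id₃ a b (η * η)))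
      (+-monoˡ-< (η * η) (a<hi² B))

  module _ (x : ℝ) (0<x : 0ᴿ <ᴿ x) where

    a : ℕ → ℚ
    a n = ∣ seq x n ∣

    br : ∀ n → Bracket (a n) n
    br n = bisect (a n) (0≤∣p∣ (seq x n)) n

    s : ℕ → ℚ
    s n = lo (br n)

    B : ℚ
    B = proj₁ (bounded {seq x} (cauchy x)) + 1ℚ

    0<B : 0ℚ < B
    0<B = +-pos (proj₁ (proj₂ (bounded {seq x} (cauchy x)))) 0<1

    a+1≤B : Eventually (λ n → a n + 1ℚ ≤ B)
    a+1≤B = ev-map (λ n → +-monoˡ-≤ 1ℚ) (proj₂ (proj₂ (bounded {seq x} (cauchy x))))

    s-cauchy : Cauchy s
    s-cauchy ε 0<ε =
      let (M , p) = abs-cauchy {seq x} (cauchy x) (½ * ε * (½ * ε)) (*-pos (half 0<ε) (half 0<ε))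
          (N , q) = ev-map narrow (ev-× a+1≤B (½^-small 0<B (half 0<ε)))
      in M ℕ.⊔ N , λ m n le₁ le₂ →
        let M≤m = ℕP.≤-trans (ℕP.m≤m⊔n M N) le₁
            M≤n = ℕP.≤-trans (ℕP.m≤m⊔n M N) le₂
            N≤m = ℕP.≤-trans (ℕP.m≤n⊔m M N) le₁
            N≤n = ℕP.≤-trans (ℕP.m≤n⊔m M N) le₂
        in ∣∣-<
          (close (br m) (br n) 0<ε (q n N≤n) (≤-<-trans (p≤∣p∣ _) (p m n M≤m M≤n)))
          (subst (_< ε) (flip (s m) (s n))
            (close (br n) (br m) 0<ε (q m N≤m) (≤-<-trans (p≤∣p∣ _) (p n m M≤n M≤m))))
      where
      narrow : ∀ n → (a n + 1ℚ ≤ B) × (½^ n * B < ½ * ε) → ½^ n * (a n + 1ℚ) < ½ * ε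
      narrow n (a+1≤ , small) = ≤-<-trans (*-monoˡ (<⇒≤ (½^-pos n)) a+1≤) small
      flip : ∀ a b → b - a ≡ - (a - b)
      flip = solve 2 (λ a b → b :- a := :- (a :- b)) refl

    root : ℝ
    root = mkℝ s s-cauchy

    0≤root : 0ᴿ ≤ᴿ root
    0≤root (ε , 0<ε , ev) = ev-contradiction
      (λ n s+ε≤0 → <-irrefl refl (<-≤-trans (+-mono-≤-< (0≤lo (br n)) 0<ε) s+ε≤0)) ev

    root² : root *ᴿ root ≃ᴿ x
    root² ε 0<ε = ev-map close² (ev-× (proj₂ (proj₂ (pos-bound x 0<x)))
      (ev-× a+1≤B (½^-small (*-pos 0<B (+-pos 0<B 0<B)) 0<ε)))
      where
      close² : ∀ n → (proj₁ (pos-bound x 0<x) ≤ seq x n)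
        × (a n + 1ℚ ≤ B) × (½^ n * (B * (B + B)) < ε) → ∣ s n * s n - seq x n ∣ < ε
      close² n (δ≤x , a+1≤ , small) = subst (λ t → ∣ s n * s n - t ∣ < ε) a≡x (∣∣-<
        (≤-<-trans (≤-from (≤-diff (lo²≤a b))
          (solve 2 (λ l a → (l :- a) :+ (a :- l) := con 0ℚ) refl (s n * s n) (a n))) 0<ε)
        (<-≤-trans gap (≤-trans gap≤ (<⇒≤ small))))
        where
        b = br n
        h = ½^ n
        a≡x : a n ≡ seq x n
        a≡x = 0≤p⇒∣p∣≡p (≤-trans (<⇒≤ (proj₁ (proj₂ (pos-bound x 0<x)))) δ≤x)
        gap : - (s n * s n - a n) < h * ((a n + 1ℚ) * (hi b + s n))
        gap = <-from (<-diff (a<hi² b))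
          (trans (cong (λ t → - (s n * s n - a n) + (t * t - a n)) (width b))
            (trans (solve 4 (λ l a h c → (:- (l :* l :- a)) :+ ((l :+ h :* c) :* (l :+ h :* c) :- a)
                                 := h :* (c :* ((l :+ h :* c) :+ l))) refl (s n) (a n) h (a n + 1ℚ))
              (cong (λ t → h * ((a n + 1ℚ) * (t + s n))) (sym (width b)))))
        hi≤B = ≤-trans (hi≤ b) a+1≤
        gap≤ : h * ((a n + 1ℚ) * (hi b + s n)) ≤ h * (B * (B + B))
        gap≤ = *-monoˡ (<⇒≤ (½^-pos n)) (*-mono
          (+-nn (0≤∣p∣ (seq x n)) (<⇒≤ 0<1)) (<⇒≤ (+-pos 0<B 0<B)) a+1≤
          (+-mono-≤ hi≤B (≤-trans (lo≤hi b) hi≤B)))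

√-exists : ∀ x → 0ᴿ <ᴿ x → ∃ λ s → 0ᴿ ≤ᴿ s × s *ᴿ s ≃ᴿ x
√-exists x 0<x = Sqrt.root x 0<x , Sqrt.0≤root x 0<x , Sqrt.root² x 0<x

-- Non-negative roots are unique up to _≃ᴿ_, so the choice of witness is immaterial.
√ : (x : ℝ) → 0ᴿ <ᴿ x → ℝ
√ x 0<x = proj₁ (√-exists x 0<x)

module _ (x c : ℝ) (0<x : 0ᴿ <ᴿ x) (0<c : 0ᴿ <ᴿ c) where

  β²-num-term β²-den-term : ℕ → ℕ → ℝ
  β²-num-term m k =
    x ^ᴿ k *ᴿ zpow c 0<c (+ m ℤ.- + (2 ℕ.* k)) *ᴿ fromℕ (m C (2 ℕ.* k))
  β²-den-term m k =
    x ^ᴿ k *ᴿ zpow c 0<c (+ m ℤ.- + (2 ℕ.* k) ℤ.- + 1) *ᴿ fromℕ (m C (2 ℕ.* k ℕ.+ 1))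

  β²-num β²-den : ℕ → ℝ
  β²-num m = Σ[0… ⌈ m /2⌉ ] (β²-num-term m)
  -- The truncated subtraction is exact for m ≥ 1.
  β²-den m = Σ[0… ⌈ m /2⌉ ℕ.∸ 1 ] (β²-den-term m)

module Positivity where

  NN : ℝ → Set
  NN x = Eventually (λ n → 0ℚ ≤ seq x n)

  pos⇒NN : ∀ x → 0ᴿ <ᴿ x → NN x
  pos⇒NN x 0<x = let (δ , 0<δ , ev) = pos-bound x 0<x in ev-map (λ n → ≤-trans (<⇒≤ 0<δ)) ev

  NN-* : ∀ x y → NN x → NN y → NN (x *ᴿ y)
  NN-* x y p q = ev-map (λ n (a , b) → *-nn a b) (ev-× p q)

  pos-* : ∀ x y → 0ᴿ <ᴿ x → 0ᴿ <ᴿ y → 0ᴿ <ᴿ x *ᴿ y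
  pos-* x y 0<x 0<y =
    let (δ , 0<δ , ev) = pos-bound x 0<x
        (η , 0<η , ev′) = pos-bound y 0<y
    in bound-pos (x *ᴿ y) (*-pos 0<δ 0<η) (ev-map
      (λ n (a , b) → *-mono (<⇒≤ 0<δ) (≤-trans (<⇒≤ 0<η) b) a b) (ev-× ev ev′))

  pos+NN : ∀ x y → 0ᴿ <ᴿ x → NN y → 0ᴿ <ᴿ x +ᴿ y
  pos+NN x y 0<x q = let (δ , 0<δ , ev) = pos-bound x 0<x in
    bound-pos (x +ᴿ y) 0<δ (ev-map
      (λ n (a , b) → subst (_≤ seq x n + seq y n) (+-identityʳ δ) (+-mono-≤ a b))
      (ev-× ev q))

  pos-fromℕ : ∀ n .{{_ : ℕ.NonZero n}} → 0ᴿ <ᴿ fromℕ n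
  pos-fromℕ n = bound-pos (fromℕ n) (ℕ→ℚ-pos n) (0 , λ _ _ → ≤-refl)

  pos-^ : ∀ x → 0ᴿ <ᴿ x → ∀ n → 0ᴿ <ᴿ x ^ᴿ n
  pos-^ x 0<x zero    = pos-fromℕ 1
  pos-^ x 0<x (suc n) = pos-* x (x ^ᴿ n) 0<x (pos-^ x 0<x n)

  pos-recip : ∀ x (0<x : 0ᴿ <ᴿ x) → 0ᴿ <ᴿ recip x 0<x
  pos-recip x 0<x =
    let (δ , 0<δ , ev) = pos-bound x 0<x
        (B , 0<B , ev′) = bounded {seq x} (cauchy x)
    in bound-pos (recip x 0<x) (inv-pos 0<B) (ev-map
      (λ n (a , b) → inv-anti (<-≤-trans 0<δ a) (≤-trans (p≤∣p∣ (seq x n)) b)) (ev-× ev ev′))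

  pos-zpow : ∀ x (0<x : 0ᴿ <ᴿ x) z → 0ᴿ <ᴿ zpow x 0<x z
  pos-zpow x 0<x (+ n)    = pos-^ x 0<x n
  pos-zpow x 0<x -[1+ n ] = pos-^ (recip x 0<x) (pos-recip x 0<x) (suc n)

  pos-Σ : ∀ f → 0ᴿ <ᴿ f 0 → (∀ k → NN (f k)) → ∀ n → 0ᴿ <ᴿ Σ[0… n ] f
  pos-Σ f 0<f0 nn zero    = 0<f0
  pos-Σ f 0<f0 nn (suc n) = pos+NN (Σ[0… n ] f) (f (suc n)) (pos-Σ f 0<f0 nn n) (nn (suc n))

open Positivity

β²-den-pos : ∀ x c 0<x 0<c m .{{_ : ℕ.NonZero m}} → 0ᴿ <ᴿ β²-den x c 0<x 0<c m
β²-den-pos x c 0<x 0<c m@(suc _) = pos-Σ (β²-den-term x c 0<x 0<c m)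
  (pos-* (head 0) (fromℕ (m C 1)) (head-pos 0)
    (subst (λ j → 0ᴿ <ᴿ fromℕ j) (sym (nC1≡n m)) (pos-fromℕ m)))
  (λ k → NN-* (head k) (fromℕ (m C (2 ℕ.* k ℕ.+ 1))) (pos⇒NN (head k) (head-pos k))
    (0 , λ _ _ → ℕ→ℚ-nn (m C (2 ℕ.* k ℕ.+ 1))))
  (⌈ m /2⌉ ℕ.∸ 1)
  where
  cpow : ℕ → ℝ
  cpow k = zpow c 0<c (+ m ℤ.- + (2 ℕ.* k) ℤ.- + 1)
  head : ℕ → ℝ
  head k = x ^ᴿ k *ᴿ cpow k
  head-pos : ∀ k → 0ᴿ <ᴿ head k
  head-pos k = pos-* (x ^ᴿ k) (cpow k) (pos-^ x 0<x k)
    (pos-zpow c 0<c (+ m ℤ.- + (2 ℕ.* k) ℤ.- + 1))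

β² : (x c : ℝ) → 0ᴿ <ᴿ x → 0ᴿ <ᴿ c → (m : ℕ) .{{_ : ℕ.NonZero m}} → ℝ
β² x c 0<x 0<c m =
  β²-num x c 0<x 0<c m *ᴿ recip (β²-den x c 0<x 0<c m) (β²-den-pos x c 0<x 0<c m)

Limit : ((m : ℕ) .{{_ : ℕ.NonZero m}} → ℝ) → ℝ → Set
Limit u l = ∀ ε → 0ᴿ <ᴿ ε →
  ∃ λ N → ∀ m .{{_ : ℕ.NonZero m}} → N ℕ.≤ m → ∣ u m -ᴿ l ∣ᴿ <ᴿ ε

{-# OPTIONS --safe #-}
module Submission where

-- Numerator A and denominator B satisfy A ± √x B = (c ± √x) ^ m, so that
-- (β − √x) / (β + √x) = ((c − √x) / (c + √x)) ^ m tends to 0. Everything is done on the n-th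
-- rational entries of the reals, where s = seq (√ x) n is a root of seq x n only up to a defect
-- d ≥ 0. For fixed m this defect perturbs the relation by at most m δ, with δ arbitrarily
-- small for large n; since n is chosen after m in the limit, δ may depend on m.

open import Defs
open ℚLemmas
open CauchyLemmas
open Positivity
open import Data.Integer as ℤ using (+_)
import Data.Integer.Properties as ℤP
open import Data.Nat as ℕ using (ℕ; zero; suc; ⌈_/2⌉)
open import Data.Nat.Combinatorics using (_C_; nCk+nC[k+1]≡[n+1]C[k+1]; k>n⇒nCk≡0)
import Data.Nat.Properties as ℕP
open import Data.Product using (∃; _×_; _,_; proj₁; proj₂)
open import Data.Rational
open import Data.Rational.Properties
open import Data.Rational.Solver using (module +-*-Solver)
open import Data.Sum using (inj₁; inj₂)
open import Algebra.Definitions.RawSemiring +-*-rawSemiring using (_^_)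
open import Relation.Binary.PropositionalEquality
  using (_≡_; refl; sym; trans; cong; cong₂; subst; subst₂; module ≡-Reasoning)
open import Relation.Nullary using (yes; no)
open +-*-Solver using (solve; con; _:+_; _:*_; _:-_; :-_; _:=_)

-- The recurrence for numerator and denominator, and its error estimates.

^-nonNeg : ∀ {p} → 0ℚ ≤ p → ∀ m → 0ℚ ≤ p ^ m
^-nonNeg 0≤p zero    = <⇒≤ 0<1
^-nonNeg 0≤p (suc m) = *-nn 0≤p (^-nonNeg 0≤p m)

-- One step multiplies `A m + √x B m` by `c + √x`; keeping the two coordinates apart avoids the
-- irrational root. Starting at `m = 0`, where the denominator is still zero, makes the base cases
-- trivial.
module Recurrence (x c : ℚ) where

  A B : ℕ → ℚ
  A zero    = 1ℚ
  A (suc m) = c * A m + x * B m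
  B zero    = 0ℚ
  B (suc m) = A m + c * B m

module _ {x c : ℚ} (0≤x : 0ℚ ≤ x) (0≤c : 0ℚ ≤ c) where

  open Recurrence x c

  A-nn : ∀ m → 0ℚ ≤ A m
  B-nn : ∀ m → 0ℚ ≤ B m
  A-nn zero    = <⇒≤ 0<1
  A-nn (suc m) = +-nn (*-nn 0≤c (A-nn m)) (*-nn 0≤x (B-nn m))
  B-nn zero    = ≤-refl
  B-nn (suc m) = +-nn (A-nn m) (*-nn 0≤c (B-nn m))

-- With f = A + sB and e = A − sB, the recurrence reads f′ = (c + s) f + dB and
-- e′ = (c − s) e + dB for d = x − s², so e / f decays like λ̂ ^ m up to an error linear in d.
module _ {x c s λ̂ δ : ℚ} (0≤c : 0ℚ ≤ c) (0≤s : 0ℚ ≤ s) (s²≤x : s * s ≤ x)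
  (0≤λ̂ : 0ℚ ≤ λ̂) (λ̂≤1 : λ̂ ≤ 1ℚ) (0≤δ : 0ℚ ≤ δ)
  (contracts : ∣ c - s ∣ ≤ λ̂ * (c + s)) (d≤ : x - s * s ≤ δ * ((c + s) * s)) where

  open Recurrence x c

  private
    e f : ℕ → ℚ
    e m = A m - s * B m
    f m = A m + s * B m
    q d : ℚ
    q = c + s
    d = x - s * s
    0≤q : 0ℚ ≤ q
    0≤q = +-nn 0≤c 0≤s
    0≤d : 0ℚ ≤ d
    0≤d = ≤-diff s²≤x
    0≤x : 0ℚ ≤ x
    0≤x = ≤-trans (*-nn 0≤s 0≤s) s²≤x
    0≤A : ∀ m → 0ℚ ≤ A m
    0≤A = A-nn 0≤x 0≤c
    0≤B : ∀ m → 0ℚ ≤ B m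
    0≤B = B-nn 0≤x 0≤c
    0≤f : ∀ m → 0ℚ ≤ f m
    0≤f m = +-nn (0≤A m) (*-nn 0≤s (0≤B m))

    f-suc : ∀ m → q * f m + d * B m ≡ f (suc m)
    f-suc m = solve 5 (λ x c s a b →
      (c :+ s) :* (a :+ s :* b) :+ (x :- s :* s) :* b
      := (c :* a :+ x :* b) :+ s :* (a :+ c :* b)) refl x c s (A m) (B m)

    e-suc : ∀ m → (c - s) * e m + d * B m ≡ e (suc m)
    e-suc m = solve 5 (λ x c s a b →
      (c :- s) :* (a :- s :* b) :+ (x :- s :* s) :* b
      := (c :* a :+ x :* b) :- s :* (a :+ c :* b)) refl x c s (A m) (B m)

    rate : ℕ → ℚ
    rate m = λ̂ ^ m + ℕ→ℚ m * δ

    0≤rate : ∀ m → 0ℚ ≤ rate m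
    0≤rate m = +-nn (^-nonNeg 0≤λ̂ m) (*-nn (ℕ→ℚ-nn m) 0≤δ)

    -- The defects of earlier steps are only damped, because `λ̂ ≤ 1`; hence they add up to at most
    -- one `δ` per step.
    rate-suc : ∀ m → λ̂ * rate m + δ ≤ rate (suc m)
    rate-suc m = ≤-from (*-nn (≤-diff λ̂≤1) (*-nn (ℕ→ℚ-nn m) 0≤δ))
      (trans (solve 4 (λ l p t δ →
          (l :* (p :+ t :* δ) :+ δ) :+ (con 1ℚ :- l) :* (t :* δ)
          := l :* p :+ (con 1ℚ :+ t) :* δ) refl λ̂ (λ̂ ^ m) (ℕ→ℚ m) δ)
        (cong (λ t → λ̂ * λ̂ ^ m + t * δ) (sym (ℕ→ℚ-suc m))))

    -- The factor `s` in the bound on `d` turns `B m` into `s * B m`, which is at most `f m` since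
    -- `A m` is nonnegative.
    dB≤ : ∀ m → d * B m ≤ δ * (q * f m)
    dB≤ m = ≤-trans (*-monoʳ (0≤B m) d≤)
      (≤-from (*-nn 0≤δ (*-nn 0≤q (0≤A m)))
        (solve 5 (λ δ q s a b → δ :* (q :* s) :* b :+ δ :* (q :* a)
          := δ :* (q :* (a :+ s :* b))) refl δ q s (A m) (B m)))

  ∣A-sB∣≤rate*[A+sB] : ∀ m → ∣ A m - s * B m ∣ ≤ (λ̂ ^ m + ℕ→ℚ m * δ) * (A m + s * B m)
  ∣A-sB∣≤rate*[A+sB] zero    = ≤-reflexive (trans (cong ∣_∣ (solve 1 (λ s →
      con 1ℚ :- s :* con 0ℚ := con 1ℚ) refl s))
    (solve 2 (λ s δ → con 1ℚ
      := (con 1ℚ :+ con 0ℚ :* δ) :* (con 1ℚ :+ s :* con 0ℚ)) refl s δ))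
  ∣A-sB∣≤rate*[A+sB] (suc m) = begin
    ∣ e (suc m) ∣                                ≡⟨ cong ∣_∣ (sym (e-suc m)) ⟩
    ∣ (c - s) * e m + d * B m ∣                  ≤⟨ ∣p+q∣≤∣p∣+∣q∣ ((c - s) * e m) (d * B m) ⟩
    ∣ (c - s) * e m ∣ + ∣ d * B m ∣              ≡⟨ cong₂ _+_ (∣p*q∣≡∣p∣*∣q∣ (c - s) (e m))
                                                      (0≤p⇒∣p∣≡p (*-nn 0≤d (0≤B m))) ⟩
    ∣ c - s ∣ * ∣ e m ∣ + d * B m                ≤⟨ +-mono-≤
                                                      (*-mono (0≤∣p∣ (c - s)) (*-nn (0≤rate m) (0≤f m))
                                                        contracts (∣A-sB∣≤rate*[A+sB] m))
                                                      (dB≤ m) ⟩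
    λ̂ * q * (rate m * f m) + δ * (q * f m)       ≡⟨ solve 5 (λ l q r f δ →
                                                      l :* q :* (r :* f) :+ δ :* (q :* f)
                                                      := (l :* r :+ δ) :* (q :* f)) refl
                                                      λ̂ q (rate m) (f m) δ ⟩
    -- By `f-suc` the defect only enlarges `f`, so `q * f m ≤ f (suc m)`.
    (λ̂ * rate m + δ) * (q * f m)                 ≤⟨ *-mono
                                                      (+-nn (*-nn 0≤λ̂ (0≤rate m)) 0≤δ) (0≤f (suc m))
                                                      (rate-suc m)
                                                      (≤-from (*-nn 0≤d (0≤B m)) (f-suc m)) ⟩
    rate (suc m) * f (suc m)                     ∎
    where open ≤-Reasoning

-- Put `r = a / b`. Dividing by `b` gives `∣r − s∣ ≤ θ (r + s)`, and `r ≤ s + ∣r − s∣` turns this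
-- into `(1 − θ) ∣r − s∣ ≤ 2 θ s`. With `θ ≤ ½` the left factor costs at most another 2, whence the
-- 4.
relative⇒absolute : ∀ {a b s θ} → 0ℚ < b → 0ℚ ≤ s → 0ℚ ≤ θ → θ ≤ ½ →
  ∣ a - s * b ∣ ≤ θ * (a + s * b) → ∣ a * inv b - s ∣ ≤ (+ 4 / 1) * (s * θ)
relative⇒absolute {a} {b} {s} {θ} 0<b 0≤s 0≤θ θ≤½ rel = ≤-from
  (+-nn (+-nn 0≤gap 0≤gap) (*-nn 0≤2 (+-nn (*-nn (≤-diff θ≤½) (0≤∣p∣ u))
    (*-nn 0≤θ (≤-diff (p≤∣p∣ u))))))
  (solve 4 (λ r s θ v → let gap = θ :* (r :+ s) :- v ; two = con 1ℚ :+ con 1ℚ in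
      v :+ ((gap :+ gap) :+ two :* ((con ½ :- θ) :* v :+ θ :* (v :- (r :- s))))
      := con (+ 4 / 1) :* (s :* θ)) refl r s θ (∣ u ∣))
  where
  r u : ℚ
  r = a * inv b
  u = r - s
  0≤2 : 0ℚ ≤ 1ℚ + 1ℚ
  0≤2 = +-nn (<⇒≤ 0<1) (<⇒≤ 0<1)
  r*b : r * b ≡ a
  r*b = trans (solve 3 (λ a b i → a :* i :* b := a :* (b :* i)) refl a b (inv b))
    (trans (cong (a *_) (inv-inverse 0<b)) (*-identityʳ a))
  scaled : ∣ u ∣ * b ≡ ∣ a - s * b ∣
  scaled = begin
    ∣ u ∣ * b       ≡⟨ cong (∣ u ∣ *_) (sym (0≤p⇒∣p∣≡p (<⇒≤ 0<b))) ⟩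
    ∣ u ∣ * ∣ b ∣   ≡⟨ sym (∣p*q∣≡∣p∣*∣q∣ u b) ⟩
    ∣ u * b ∣       ≡⟨ cong ∣_∣ (solve 3 (λ r s b → (r :- s) :* b := r :* b :- s :* b) refl r s b) ⟩
    ∣ r * b - s * b ∣ ≡⟨ cong (λ t → ∣ t - s * b ∣) r*b ⟩
    ∣ a - s * b ∣   ∎
    where open ≡-Reasoning
  ∣u∣≤ : ∣ u ∣ ≤ θ * (r + s)
  ∣u∣≤ = *-cancelʳ-≤-pos b {{positive 0<b}} (subst₂ _≤_ (sym scaled)
    (trans (cong (λ t → θ * (t + s * b)) (sym r*b))
      (solve 4 (λ θ r s b → θ :* (r :* b :+ s :* b) := θ :* (r :+ s) :* b) refl θ r s b))
    rel)
  0≤gap : 0ℚ ≤ θ * (r + s) - ∣ u ∣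
  0≤gap = ≤-diff ∣u∣≤

-- Bernoulli's inequality for `1 + h`, multiplied through by the reciprocal power. The induction
-- step is `1 + (m + 1) h ≤ (1 + h) (1 + m h)`, with slack `m h²`.
^-bernoulli : ∀ {h} → 0ℚ ≤ h → ∀ m → inv (1ℚ + h) ^ m * (1ℚ + ℕ→ℚ m * h) ≤ 1ℚ
^-bernoulli {h} 0≤h = go
  where
  l : ℚ
  l = inv (1ℚ + h)
  0<1+h : 0ℚ < 1ℚ + h
  0<1+h = +-mono-<-≤ 0<1 0≤h
  0≤l : 0ℚ ≤ l
  0≤l = <⇒≤ (inv-pos 0<1+h)
  go : ∀ m → l ^ m * (1ℚ + ℕ→ℚ m * h) ≤ 1ℚ
  go zero    = ≤-reflexive (solve 1 (λ h → con 1ℚ :* (con 1ℚ :+ con 0ℚ :* h) := con 1ℚ) refl h)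
  go (suc m) = ≤-trans
    (≤-from (*-nn (*-nn 0≤l (^-nonNeg 0≤l m)) (*-nn (ℕ→ℚ-nn m) (*-nn 0≤h 0≤h)))
      (trans (cong (λ t → l * l ^ m * (1ℚ + t * h) + l * l ^ m * (ℕ→ℚ m * (h * h))) (ℕ→ℚ-suc m))
        (trans (solve 4 (λ l p t h →
            l :* p :* (con 1ℚ :+ (con 1ℚ :+ t) :* h) :+ l :* p :* (t :* (h :* h))
            := (con 1ℚ :+ h) :* l :* (p :* (con 1ℚ :+ t :* h))) refl l (l ^ m) (ℕ→ℚ m) h)
          (trans (cong (_* (l ^ m * (1ℚ + ℕ→ℚ m * h))) (inv-inverse 0<1+h)) (*-identityˡ _)))))
    (go m)

-- Binomial sums as solutions of the recurrence.

binomTerm : ℚ → ℕ → ℕ → ℚ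
binomTerm c m j = c ^ (m ℕ.∸ j) * ℕ→ℚ (m C j)

ℕ→ℚ-+ : ∀ m n → ℕ→ℚ (m ℕ.+ n) ≡ ℕ→ℚ m + ℕ→ℚ n
ℕ→ℚ-+ zero    n = sym (+-identityˡ (ℕ→ℚ n))
ℕ→ℚ-+ (suc m) n = begin
  ℕ→ℚ (suc (m ℕ.+ n))        ≡⟨ ℕ→ℚ-suc (m ℕ.+ n) ⟩
  1ℚ + ℕ→ℚ (m ℕ.+ n)         ≡⟨ cong (λ t → 1ℚ + t) (ℕ→ℚ-+ m n) ⟩
  1ℚ + (ℕ→ℚ m + ℕ→ℚ n)       ≡⟨ sym (+-assoc 1ℚ (ℕ→ℚ m) (ℕ→ℚ n)) ⟩
  1ℚ + ℕ→ℚ m + ℕ→ℚ n         ≡⟨ cong (_+ ℕ→ℚ n) (sym (ℕ→ℚ-suc m)) ⟩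
  ℕ→ℚ (suc m) + ℕ→ℚ n        ∎
  where open ≡-Reasoning

*-C-vanishes : ∀ {m j} p → m ℕ.< j → p * ℕ→ℚ (m C j) ≡ 0ℚ
*-C-vanishes p m<j = trans (cong (λ t → p * ℕ→ℚ t) (k>n⇒nCk≡0 m<j)) (*-zeroʳ p)

binomTerm-zero : ∀ c m → binomTerm c (suc m) 0 ≡ c * binomTerm c m 0
binomTerm-zero c m = *-assoc c (c ^ m) 1ℚ

binomTerm-pascal : ∀ c m j →
  binomTerm c (suc m) (suc j) ≡ binomTerm c m j + c * binomTerm c m (suc j)
binomTerm-pascal c m j = begin
  p * ℕ→ℚ (suc m C suc j)              ≡⟨ cong (λ t → p * ℕ→ℚ t) (sym (nCk+nC[k+1]≡[n+1]C[k+1] m j)) ⟩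
  p * ℕ→ℚ (m C j ℕ.+ m C suc j)        ≡⟨ cong (p *_) (ℕ→ℚ-+ (m C j) (m C suc j)) ⟩
  p * (ℕ→ℚ (m C j) + ℕ→ℚ (m C suc j))  ≡⟨ *-distribˡ-+ p _ _ ⟩
  binomTerm c m j + p * ℕ→ℚ (m C suc j) ≡⟨ cong (λ t → binomTerm c m j + t) shift ⟩
  binomTerm c m j + c * binomTerm c m (suc j) ∎
  where
  open ≡-Reasoning
  p = c ^ (m ℕ.∸ j)
  shift : p * ℕ→ℚ (m C suc j) ≡ c * binomTerm c m (suc j)
  -- For `j ≥ m` the truncated exponents no longer differ by one, but then `m C suc j` is zero and
  -- both sides vanish.
  shift with suc j ℕ.≤? m
  ... | yes j<m = trans (cong (λ t → c ^ t * ℕ→ℚ (m C suc j)) (ℕP.+-∸-assoc 1 j<m))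
    (*-assoc c _ _)
  ... | no  j≮m = trans (*-C-vanishes p (ℕP.≰⇒> j≮m))
    (sym (trans (cong (c *_) (*-C-vanishes (c ^ (m ℕ.∸ suc j)) (ℕP.≰⇒> j≮m))) (*-zeroʳ c)))

Σℚ[0…_] : ℕ → (ℕ → ℚ) → ℚ
Σℚ[0… zero  ] f = f 0
Σℚ[0… suc n ] f = Σℚ[0… n ] f + f (suc n)

module _ (x c : ℚ) where

  open Recurrence x c

  evenTerm oddTerm : ℕ → ℕ → ℚ
  evenTerm m k = x ^ k * binomTerm c m (2 ℕ.* k)
  oddTerm  m k = x ^ k * binomTerm c m (2 ℕ.* k ℕ.+ 1)

  evenTerm-zero : ∀ m → evenTerm (suc m) 0 ≡ c * evenTerm m 0
  evenTerm-zero m = trans (cong (1ℚ *_) (binomTerm-zero c m))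
    (solve 2 (λ c b → con 1ℚ :* (c :* b) := c :* (con 1ℚ :* b)) refl c (binomTerm c m 0))

  evenTerm-suc : ∀ m k → evenTerm (suc m) (suc k) ≡ c * evenTerm m (suc k) + x * oddTerm m k
  evenTerm-suc m k = begin
    x * x ^ k * binomTerm c (suc m) (2 ℕ.* suc k)
      ≡⟨ cong (λ j → x * x ^ k * binomTerm c (suc m) j) eq ⟩
    x * x ^ k * binomTerm c (suc m) (suc (2 ℕ.* k ℕ.+ 1))
      ≡⟨ cong (x * x ^ k *_) (binomTerm-pascal c m (2 ℕ.* k ℕ.+ 1)) ⟩
    x * x ^ k * (binomTerm c m (2 ℕ.* k ℕ.+ 1) + c * binomTerm c m (suc (2 ℕ.* k ℕ.+ 1)))
      ≡⟨ solve 5 (λ x p b c b′ → x :* p :* (b :+ c :* b′) := c :* (x :* p :* b′) :+ x :* (p :* b))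
           refl x (x ^ k) _ c _ ⟩
    c * (x * x ^ k * binomTerm c m (suc (2 ℕ.* k ℕ.+ 1))) + x * oddTerm m k
      ≡⟨ cong (λ j → c * (x * x ^ k * binomTerm c m j) + x * oddTerm m k) (sym eq) ⟩
    c * evenTerm m (suc k) + x * oddTerm m k ∎
    where
    open ≡-Reasoning
    eq : 2 ℕ.* suc k ≡ suc (2 ℕ.* k ℕ.+ 1)
    eq = trans (ℕP.*-suc 2 k) (cong suc (ℕP.+-comm 1 (2 ℕ.* k)))

  oddTerm-suc : ∀ m k → oddTerm (suc m) k ≡ evenTerm m k + c * oddTerm m k
  oddTerm-suc m k = begin
    x ^ k * binomTerm c (suc m) (2 ℕ.* k ℕ.+ 1)
      ≡⟨ cong (λ j → x ^ k * binomTerm c (suc m) j) eq ⟩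
    x ^ k * binomTerm c (suc m) (suc (2 ℕ.* k))
      ≡⟨ cong (x ^ k *_) (binomTerm-pascal c m (2 ℕ.* k)) ⟩
    x ^ k * (binomTerm c m (2 ℕ.* k) + c * binomTerm c m (suc (2 ℕ.* k)))
      ≡⟨ solve 4 (λ p b c b′ → p :* (b :+ c :* b′) := p :* b :+ c :* (p :* b′)) refl (x ^ k) _ c _ ⟩
    evenTerm m k + c * (x ^ k * binomTerm c m (suc (2 ℕ.* k)))
      ≡⟨ cong (λ j → evenTerm m k + c * (x ^ k * binomTerm c m j)) (sym eq) ⟩
    evenTerm m k + c * oddTerm m k ∎
    where
    open ≡-Reasoning
    eq : 2 ℕ.* k ℕ.+ 1 ≡ suc (2 ℕ.* k)
    eq = ℕP.+-comm (2 ℕ.* k) 1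

  Σ-oddTerm-suc : ∀ m K →
    Σℚ[0… K ] (oddTerm (suc m)) ≡ Σℚ[0… K ] (evenTerm m) + c * Σℚ[0… K ] (oddTerm m)
  Σ-oddTerm-suc m zero    = oddTerm-suc m 0
  Σ-oddTerm-suc m (suc K) = trans (cong₂ _+_ (Σ-oddTerm-suc m K) (oddTerm-suc m (suc K)))
    (solve 5 (λ a c b u v → (a :+ c :* b) :+ (u :+ c :* v) := (a :+ u) :+ c :* (b :+ v)) refl
      (Σℚ[0… K ] (evenTerm m)) c (Σℚ[0… K ] (oddTerm m)) (evenTerm m (suc K)) (oddTerm m (suc K)))

  -- Pascal's rule sends the odd index `2k + 1` to the even index `2k + 2`, while index 0 has no odd
  -- predecessor; so the odd sum stops one term earlier.
  Σ-evenTerm-suc : ∀ m K →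
    Σℚ[0… suc K ] (evenTerm (suc m)) ≡ c * Σℚ[0… suc K ] (evenTerm m) + x * Σℚ[0… K ] (oddTerm m)
  Σ-evenTerm-suc m zero    = trans (cong₂ _+_ (evenTerm-zero m) (evenTerm-suc m 0))
    (solve 5 (λ c a u x v → c :* a :+ (c :* u :+ x :* v) := c :* (a :+ u) :+ x :* v) refl
      c _ _ x _)
  Σ-evenTerm-suc m (suc K) = trans (cong₂ _+_ (Σ-evenTerm-suc m K) (evenTerm-suc m (suc K)))
    (solve 6 (λ c a x b u v → (c :* a :+ x :* b) :+ (c :* u :+ x :* v)
      := c :* (a :+ u) :+ x :* (b :+ v)) refl c (Σℚ[0… suc K ] (evenTerm m)) x (Σℚ[0… K ] (oddTerm m))
      (evenTerm m (suc (suc K))) (oddTerm m (suc K)))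

  Σ-evenTerm-0 : ∀ K → Σℚ[0… K ] (evenTerm 0) ≡ 1ℚ
  Σ-evenTerm-0 zero    = refl
  Σ-evenTerm-0 (suc K) = cong₂ _+_ (Σ-evenTerm-0 K)
    (trans (cong (x ^ suc K *_) (*-C-vanishes {j = 2 ℕ.* suc K} 1ℚ (ℕ.s≤s ℕ.z≤n))) (*-zeroʳ (x ^ suc K)))

  Σ-oddTerm-0 : ∀ K → Σℚ[0… K ] (oddTerm 0) ≡ 0ℚ
  Σ-oddTerm-0 zero    = refl
  Σ-oddTerm-0 (suc K) = cong₂ _+_ (Σ-oddTerm-0 K)
    (trans (cong (x ^ suc K *_) (*-C-vanishes {j = 2 ℕ.* suc K} 1ℚ (ℕ.s≤s ℕ.z≤n))) (*-zeroʳ (x ^ suc K)))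

  -- The bounds on `m` say that the first omitted index, `2K + 2` here and `2K + 3` for the odd sum,
  -- exceeds `m`, so nothing nonzero is cut off. Each bound at `suc m` yields the bounds at `m` that
  -- the mutual induction calls for.
  Σ-evenTerm≡A : ∀ m K → m ℕ.≤ suc (2 ℕ.* K) → Σℚ[0… K ] (evenTerm m) ≡ A m
  Σ-oddTerm≡B : ∀ m K → m ℕ.≤ suc (suc (2 ℕ.* K)) → Σℚ[0… K ] (oddTerm m) ≡ B m

  Σ-evenTerm≡A zero K m≤ = Σ-evenTerm-0 K
  -- `Σ-evenTerm-suc` requires a nonzero upper limit, so `K = 0` is settled separately; the bound
  -- leaves only `m ≤ 1`.
  Σ-evenTerm≡A (suc zero) zero _ = trans (evenTerm-zero 0)
    (solve 2 (λ c x → c :* con 1ℚ := c :* con 1ℚ :+ x :* con 0ℚ) refl c x)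
  Σ-evenTerm≡A (suc (suc m)) zero (ℕ.s≤s ())
  Σ-evenTerm≡A (suc m) (suc K) (ℕ.s≤s m≤) = trans (Σ-evenTerm-suc m K)
    (cong₂ (λ a b → c * a + x * b)
      (Σ-evenTerm≡A m (suc K) (ℕP.m≤n⇒m≤1+n m≤))
      (Σ-oddTerm≡B m K (subst (m ℕ.≤_) (ℕP.*-suc 2 K) m≤)))

  Σ-oddTerm≡B zero K m≤ = Σ-oddTerm-0 K
  Σ-oddTerm≡B (suc m) K (ℕ.s≤s m≤) = trans (Σ-oddTerm-suc m K)
    (cong₂ (λ a b → a + c * b) (Σ-evenTerm≡A m K m≤) (Σ-oddTerm≡B m K (ℕP.m≤n⇒m≤1+n m≤)))

-- Rational entries of the real numerator and denominator.

seq-^ : ∀ x k n → seq (x ^ᴿ k) n ≡ seq x n ^ k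
seq-^ x zero    n = refl
seq-^ x (suc k) n = cong (seq x n *_) (seq-^ x k n)

seq-Σ : ∀ {f g n} → (∀ k → seq (f k) n ≡ g k) → ∀ K → seq (Σ[0… K ] f) n ≡ Σℚ[0… K ] g
seq-Σ f≡g zero    = f≡g 0
seq-Σ f≡g (suc K) = cong₂ _+_ (seq-Σ f≡g K) (f≡g (suc K))

m≤2⌈m/2⌉ : ∀ m → m ℕ.≤ 2 ℕ.* ⌈ m /2⌉
m≤2⌈m/2⌉ zero          = ℕ.z≤n
m≤2⌈m/2⌉ (suc zero)    = ℕ.s≤s ℕ.z≤n
m≤2⌈m/2⌉ (suc (suc m)) = subst (suc (suc m) ℕ.≤_) (sym (ℕP.*-suc 2 ⌈ m /2⌉))
  (ℕ.s≤s (ℕ.s≤s (m≤2⌈m/2⌉ m)))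

module _ (x c : ℝ) (0<x : 0ᴿ <ᴿ x) (0<c : 0ᴿ <ᴿ c) (n : ℕ) where

  open Recurrence (seq x n) (seq c n)

  -- Negative exponents occur only beside a vanishing binomial coefficient, so reciprocals never
  -- have to be computed. The exponent `z` is kept free because the denominator writes it as two
  -- successive subtractions.
  zpow-binomTerm : ∀ m j {z} → z ≡ + m ℤ.- + j →
    seq (zpow c 0<c z) n * ℕ→ℚ (m C j) ≡ binomTerm (seq c n) m j
  zpow-binomTerm m j {z} z≡ with j ℕ.≤? m
  ... | yes j≤m = cong (_* ℕ→ℚ (m C j)) (trans
    (cong (λ i → seq (zpow c 0<c i) n) (trans z≡ (trans (ℤP.m-n≡m⊖n m j) (ℤP.⊖-≥ j≤m))))
    (seq-^ c (m ℕ.∸ j) n))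
  ... | no  j≰m = trans (*-C-vanishes (seq (zpow c 0<c z) n) (ℕP.≰⇒> j≰m))
    (sym (*-C-vanishes (seq c n ^ (m ℕ.∸ j)) (ℕP.≰⇒> j≰m)))

  seq-num-term : ∀ m k →
    seq (β²-num-term x c 0<x 0<c m k) n ≡ evenTerm (seq x n) (seq c n) m k
  seq-num-term m k = trans (*-assoc (seq (x ^ᴿ k) n) (seq (zpow c 0<c (+ m ℤ.- + (2 ℕ.* k))) n) (ℕ→ℚ (m C (2 ℕ.* k))))
    (cong₂ _*_ (seq-^ x k n) (zpow-binomTerm m (2 ℕ.* k) refl))

  seq-den-term : ∀ m k →
    seq (β²-den-term x c 0<x 0<c m k) n ≡ oddTerm (seq x n) (seq c n) m k
  seq-den-term m k = trans (*-assoc (seq (x ^ᴿ k) n) (seq (zpow c 0<c (+ m ℤ.- + (2 ℕ.* k) ℤ.- + 1)) n) (ℕ→ℚ (m C (2 ℕ.* k ℕ.+ 1))))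
    (cong₂ _*_ (seq-^ x k n) (zpow-binomTerm m (2 ℕ.* k ℕ.+ 1) exponent))
    where
    exponent : + m ℤ.- + (2 ℕ.* k) ℤ.- + 1 ≡ + m ℤ.- + (2 ℕ.* k ℕ.+ 1)
    exponent = trans (ℤP.+-assoc (+ m) (ℤ.- (+ (2 ℕ.* k))) (ℤ.- (+ 1)))
      (cong (λ i → + m ℤ.+ i) (sym (ℤP.neg-distrib-+ (+ (2 ℕ.* k)) (+ 1))))

  seq-num : ∀ m → seq (β²-num x c 0<x 0<c m) n ≡ A m
  seq-num m = trans (seq-Σ (seq-num-term m) ⌈ m /2⌉)
    (Σ-evenTerm≡A _ _ m ⌈ m /2⌉ (ℕP.m≤n⇒m≤1+n (m≤2⌈m/2⌉ m)))

  seq-den : ∀ m .{{_ : ℕ.NonZero m}} → seq (β²-den x c 0<x 0<c m) n ≡ B m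
  seq-den m@(suc m′) = trans (seq-Σ (seq-den-term m) (⌈ m /2⌉ ℕ.∸ 1))
    -- For `m ≥ 1` the truncated subtraction is exact, so with `K = ⌈ m /2⌉ ∸ 1` the required bound
    -- `2 + 2K` is `2 * ⌈ m /2⌉`.
    (Σ-oddTerm≡B _ _ m (⌈ m /2⌉ ℕ.∸ 1) (subst (m ℕ.≤_) (ℕP.*-suc 2 (⌈ m /2⌉ ℕ.∸ 1)) (m≤2⌈m/2⌉ m)))

-- Geometric decay and a uniform contraction factor.

∣∣-≤ : ∀ {p r} → p ≤ r → - p ≤ r → ∣ p ∣ ≤ r
∣∣-≤ {p} {r} p≤r -p≤r with ∣p∣≡p∨∣p∣≡-p p
... | inj₁ eq = subst (_≤ r) (sym eq) p≤r
... | inj₂ eq = subst (_≤ r) (sym eq) -p≤r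

⊓-pos : ∀ {p q} → 0ℚ < p → 0ℚ < q → 0ℚ < p ⊓ q
⊓-pos {p} {q} 0<p 0<q with ⊓-sel p q
... | inj₁ eq = subst (0ℚ <_) (sym eq) 0<p
... | inj₂ eq = subst (0ℚ <_) (sym eq) 0<q

inv-1+ : ∀ {h} → 0ℚ ≤ h → inv (1ℚ + h) ≤ 1ℚ
inv-1+ 0≤h = inv-anti 0<1 (≤-from 0≤h refl)

^-small : ∀ {h η} → 0ℚ < h → 0ℚ < η → Eventually (λ m → inv (1ℚ + h) ^ m ≤ η)
-- With `K = 1 / (h η)`, every `m ≥ K` has `(1 + m h) η ≥ 1`, and Bernoulli's inequality then bounds
-- the power by `η`.
^-small {h} {η} 0<h 0<η with shrink (*-pos 0<h 0<η) 0<1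
... | K , 0<K , hηK≡1 with archimedean K
...   | M , K≤M = M , λ m M≤m →
  let l = inv (1ℚ + h) ^ m
      t = ℕ→ℚ m
      1≤ : 1ℚ ≤ (1ℚ + t * h) * η
      1≤ = subst (_≤ (1ℚ + t * h) * η) hηK≡1 (≤-from
        (+-nn (<⇒≤ 0<η) (*-nn (<⇒≤ (*-pos 0<h 0<η)) (≤-diff (≤-trans K≤M (ℕ→ℚ-mono M≤m)))))
        (solve 4 (λ h η k t → h :* η :* k :+ (η :+ h :* η :* (t :- k))
          := (con 1ℚ :+ t :* h) :* η) refl h η K t))
  in begin
    l                        ≡⟨ sym (*-identityʳ l) ⟩
    l * 1ℚ                   ≤⟨ *-monoˡ (^-nonNeg (<⇒≤ (inv-pos (+-mono-<-≤ 0<1 (<⇒≤ 0<h)))) m) 1≤ ⟩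
    l * ((1ℚ + t * h) * η)   ≡⟨ sym (*-assoc l (1ℚ + t * h) η) ⟩
    l * (1ℚ + t * h) * η     ≤⟨ *-monoʳ (<⇒≤ 0<η) (^-bernoulli (<⇒≤ 0<h) m) ⟩
    1ℚ * η                   ≡⟨ *-identityˡ η ⟩
    η                        ∎
  where open ≤-Reasoning

-- Since `∣a − b∣ = a + b − 2 min(a, b) ≤ a + b − 2μ`, there is room for a further `h ∣a − b∣ ≤ h (a
-- + b) ≤ q h = 2μ`. As `h` depends only on `μ` and `q`, one factor serves all entries within these
-- bounds.
∣a-b∣≤inv[1+h]*[a+b] : ∀ {a b μ q h} → 0ℚ ≤ μ → μ ≤ a → μ ≤ b → a + b ≤ q → 0ℚ ≤ h → q * h ≡ μ + μ →
  ∣ a - b ∣ ≤ inv (1ℚ + h) * (a + b)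
∣a-b∣≤inv[1+h]*[a+b] {a} {b} {μ} {q} {h} 0≤μ μ≤a μ≤b a+b≤q 0≤h qh≡2μ = subst (_≤ l * (a + b)) cancel
  (*-monoˡ (<⇒≤ (inv-pos 0<1+h)) p[1+h]≤a+b)
  where
  l p : ℚ
  l = inv (1ℚ + h)
  p = ∣ a - b ∣
  0<1+h : 0ℚ < 1ℚ + h
  0<1+h = +-mono-<-≤ 0<1 0≤h
  cancel : l * (p * (1ℚ + h)) ≡ p
  cancel = trans (solve 3 (λ l p k → l :* (p :* k) := k :* l :* p) refl l p (1ℚ + h))
    (trans (cong (_* p) (inv-inverse 0<1+h)) (*-identityˡ p))
  p≤ : p ≤ (a + b) - (μ + μ)
  p≤ = ∣∣-≤
    (≤-from (+-nn (≤-diff μ≤b) (≤-diff μ≤b))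
      (solve 3 (λ a b μ → (a :- b) :+ ((b :- μ) :+ (b :- μ)) := (a :+ b) :- (μ :+ μ)) refl a b μ))
    (≤-from (+-nn (≤-diff μ≤a) (≤-diff μ≤a))
      (solve 3 (λ a b μ → (:- (a :- b)) :+ ((a :- μ) :+ (a :- μ)) := (a :+ b) :- (μ :+ μ)) refl a b μ))
  p≤a+b : p ≤ a + b
  p≤a+b = ≤-trans p≤ (≤-from (+-nn 0≤μ 0≤μ)
    (solve 2 (λ s μ → s :- μ :+ μ := s) refl (a + b) (μ + μ)))
  p[1+h]≤a+b : p * (1ℚ + h) ≤ a + b
  p[1+h]≤a+b = ≤-from
    (+-nn (≤-diff p≤) (+-nn (*-nn (≤-diff p≤a+b) 0≤h) (*-nn (≤-diff a+b≤q) 0≤h)))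
    (trans (solve 5 (λ p s q h u → p :* (con 1ℚ :+ h) :+ ((s :- u :- p) :+ ((s :- p) :* h :+ (q :- s) :* h))
        := s :+ (q :* h :- u)) refl p (a + b) q h (μ + μ))
      (trans (cong (λ t → (a + b) + (t - (μ + μ))) qh≡2μ)
        (solve 2 (λ s u → s :+ (u :- u) := s) refl (a + b) (μ + μ))))

-- Entries of the square root.

module _ (x : ℝ) (0<x : 0ᴿ <ᴿ x) where

  0≤seq-√ : ∀ n → 0ℚ ≤ seq (√ x 0<x) n
  0≤seq-√ n = Sqrt.Bracket.0≤lo (Sqrt.br x 0<x n)

  -- Bisection records lower endpoints, whose squares stay below `∣ seq x n ∣`; the absolute value
  -- drops out once the entries of `x` are nonnegative. This fixes the sign of the defect.
  seq-√²≤ : Eventually (λ n → seq (√ x 0<x) n * seq (√ x 0<x) n ≤ seq x n)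
  seq-√²≤ = ev-map
    (λ n 0≤xₙ → subst (seq (√ x 0<x) n * seq (√ x 0<x) n ≤_) (0≤p⇒∣p∣≡p 0≤xₙ)
      (Sqrt.Bracket.lo²≤a (Sqrt.br x 0<x n)))
    (pos⇒NN x 0<x)

  seq-√²-close : ∀ {ε} → 0ℚ < ε →
    Eventually (λ n → seq x n - seq (√ x 0<x) n * seq (√ x 0<x) n ≤ ε)
  seq-√²-close {ε} 0<ε = ev-map
    (λ n close → <⇒≤ (≤-<-trans (p≤∣p∣ _)
      (subst (_< ε) (swap-∣-∣ (seq (√ x 0<x) n * seq (√ x 0<x) n) (seq x n)) close)))
    (proj₂ (proj₂ (√-exists x 0<x)) ε 0<ε)

  -- With `δ ≤ x` and `s ≤ S`, eventually `S s ≥ s² ≥ x − δ/2 ≥ δ/2`, which bounds `s` below by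
  -- `σ = δ / (2 S)`.
  √-pos : 0ᴿ <ᴿ √ x 0<x
  √-pos =
    let (δ , 0<δ , δ≤x) = pos-bound x 0<x
        (S , 0<S , s≤S) = bounded {seq (√ x 0<x)} (cauchy (√ x 0<x))
        (σ , 0<σ , Sσ≡½δ) = shrink 0<S (half 0<δ)
    in bound-pos (√ x 0<x) 0<σ (ev-map
      (λ n (δ≤xₙ , sₙ≤S , close) → let s = seq (√ x 0<x) n in
        *-cancelˡ-≤-pos S {{positive 0<S}} (subst (_≤ S * s) (sym Sσ≡½δ) (≤-trans
          (≤-from (+-nn (≤-diff δ≤xₙ) (≤-diff close))
            (solve 3 (λ δ x t → con ½ :* δ :+ ((x :- δ) :+ (con ½ :* δ :- (x :- t))) := t) refl
              δ (seq x n) (s * s)))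
          (*-monoʳ (0≤seq-√ n) (≤-trans (p≤∣p∣ s) sₙ≤S)))))
      (ev-× δ≤x (ev-× s≤S (seq-√²-close (half 0<δ)))))

-- Convergence of the approximants.

module _ (x c : ℝ) (0<x : 0ᴿ <ᴿ x) (0<c : 0ᴿ <ᴿ c) where

  private
    s : ℕ → ℚ
    s = seq (√ x 0<x)
    module R n = Recurrence (seq x n) (seq c n)

  contraction : ∃ λ h → 0ℚ < h ×
    Eventually (λ n → ∣ seq c n - s n ∣ ≤ inv (1ℚ + h) * (seq c n + s n))
  contraction =
    let (σ , 0<σ , σ≤s) = pos-bound (√ x 0<x) (√-pos x 0<x)
        (γ , 0<γ , γ≤c) = pos-bound c 0<c
        (Q , 0<Q , ≤Q)  = bounded {seq (c +ᴿ √ x 0<x)} (cauchy (c +ᴿ √ x 0<x))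
        0<μ             = ⊓-pos 0<γ 0<σ
        (h , 0<h , Qh≡) = shrink 0<Q (+-pos 0<μ 0<μ)
    in h , 0<h , ev-map
      (λ n (σ≤sₙ , γ≤cₙ , sum≤Q) → ∣a-b∣≤inv[1+h]*[a+b] (<⇒≤ 0<μ)
        (≤-trans (p⊓q≤p γ σ) γ≤cₙ) (≤-trans (p⊓q≤q γ σ) σ≤sₙ)
        (≤-trans (p≤∣p∣ _) sum≤Q) (<⇒≤ 0<h) Qh≡)
      (ev-× σ≤s (ev-× γ≤c ≤Q))

  -- Half of `θ` pays for the geometric term, which fixes how large `m` must be; the other half pays
  -- for the accumulated defects, which fixes how large `n` must be for that `m`.
  relative-error : ∀ {θ} → 0ℚ < θ → Eventually (λ m → Eventually (λ n →
    ∣ R.A n m - s n * R.B n m ∣ ≤ θ * (R.A n m + s n * R.B n m)))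
  relative-error {θ} 0<θ =
    let (σ , 0<σ , σ≤s) = pos-bound (√ x 0<x) (√-pos x 0<x)
        (h , 0<h , contracts) = contraction
        0≤λ̂ = <⇒≤ (inv-pos (+-mono-<-≤ 0<1 (<⇒≤ 0<h)))
    in ev-map
      (λ m λ̂^m≤ →
        -- Dividing by `1 + m` instead of `m` keeps the divisor positive at `m = 0`.
        let (δ , 0<δ , mδ≡) = shrink (+-mono-<-≤ 0<1 (ℕ→ℚ-nn m)) (half 0<θ)
            rate≤θ : inv (1ℚ + h) ^ m + ℕ→ℚ m * δ ≤ θ
            rate≤θ = ≤-from (+-nn (≤-diff λ̂^m≤) (<⇒≤ 0<δ))
              (trans (solve 4 (λ l t δ η → (l :+ t :* δ) :+ ((η :- l) :+ δ) := η :+ (con 1ℚ :+ t) :* δ)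
                  refl (inv (1ℚ + h) ^ m) (ℕ→ℚ m) δ (½ * θ))
                (trans (cong (λ t → ½ * θ + t) mδ≡) (half+half θ)))
        in ev-map
          (λ n (0≤c , s²≤x , σ≤sₙ , contr , close) →
            let 0≤s = 0≤seq-√ x 0<x n
                0≤x = ≤-trans (*-nn 0≤s 0≤s) s²≤x
                -- A defect of at most `δ σ²` suffices, because `σ² ≤ (c + s) s`.
                σσ≤ = *-mono (<⇒≤ 0<σ) 0≤s (≤-trans σ≤sₙ (≤-from 0≤c (+-comm (s n) (seq c n)))) σ≤sₙ
            in ≤-trans
              (∣A-sB∣≤rate*[A+sB] 0≤c 0≤s s²≤x 0≤λ̂ (inv-1+ (<⇒≤ 0<h)) (<⇒≤ 0<δ) contr
                (≤-trans close (*-monoˡ (<⇒≤ 0<δ) σσ≤)) m)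
              (*-monoʳ (+-nn (A-nn 0≤x 0≤c m) (*-nn 0≤s (B-nn 0≤x 0≤c m))) rate≤θ))
          (ev-× (pos⇒NN c 0<c) (ev-× (seq-√²≤ x 0<x) (ev-× σ≤s (ev-× contracts
            (seq-√²-close x 0<x (*-pos 0<δ (*-pos 0<σ 0<σ))))))))
      (^-small 0<h (half 0<θ))

theorem3p3 : (x c : ℝ) (0<x : 0ᴿ <ᴿ x) (0<c : 0ᴿ <ᴿ c) →
    Limit (β² x c 0<x 0<c) (√ x 0<x)
theorem3p3 x c 0<x 0<c ε 0<ε =
  let (ε₀ , 0<ε₀ , ε₀≤ε)  = pos-bound ε 0<ε
      (S , 0<S , s≤S)     = bounded {seq (√ x 0<x)} (cauchy (√ x 0<x))
      -- The absolute error is at most `4 s θ ≤ 4 S θ′`, set equal to `ε₀ / 2`; the cap at `½` below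
      -- is what `relative⇒absolute` demands.
      (θ′ , 0<θ′ , 4Sθ′≡) = shrink (*-pos 0<4 0<S) (half 0<ε₀)
      θ                   = ½ ⊓ θ′
      0<θ                 = ⊓-pos 0<½ 0<θ′
      (M , rel)           = relative-error x c 0<x 0<c 0<θ
  -- The relation `_<ᴿ_` asks for a uniform gap: the error uses one half of `ε₀` and the other half
  -- is the gap.
  in M , λ m M≤m → ½ * ε₀ , half 0<ε₀ , ev-map
    (λ n (relₙ , β≤den , sₙ≤S , ε₀≤εₙ) →
      let open Recurrence (seq x n) (seq c n)
          s    = seq (√ x 0<x) n
          0<B  = subst (0ℚ <_) (seq-den x c 0<x 0<c n m)
                   (<-≤-trans (proj₁ (proj₂ (den-bound m))) β≤den)
          err  : ∣ A m * inv (B m) - s ∣ ≤ ½ * ε₀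
          err  = ≤-trans
            (relative⇒absolute {a = A m} 0<B (0≤seq-√ x 0<x n) (<⇒≤ 0<θ) (p⊓q≤p ½ θ′) relₙ)
            (≤-trans
              (*-monoˡ (<⇒≤ 0<4) (*-mono (0≤seq-√ x 0<x n) (<⇒≤ 0<θ′)
                (≤-trans (p≤∣p∣ s) sₙ≤S) (p⊓q≤q ½ θ′)))
              (≤-reflexive (trans (sym (*-assoc (+ 4 / 1) S θ′)) 4Sθ′≡)))
          err′ = subst₂ (λ a b → ∣ a * inv b - s ∣ ≤ ½ * ε₀)
                   (sym (seq-num x c 0<x 0<c n m)) (sym (seq-den x c 0<x 0<c n m)) err
      in ≤-trans (+-monoˡ-≤ (½ * ε₀) err′) (≤-trans (≤-reflexive (half+half ε₀)) ε₀≤εₙ))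
    (ev-× (rel m M≤m) (ev-× (proj₂ (proj₂ (den-bound m))) (ev-× s≤S ε₀≤ε)))
  where
  0<4 : 0ℚ < + 4 / 1
  0<4 = ℕ→ℚ-pos 4
  den-bound : ∀ m .{{_ : ℕ.NonZero m}} → _
  den-bound m = pos-bound (β²-den x c 0<x 0<c m) (β²-den-pos x c 0<x 0<c m)
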